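{- For every $n\ge 1$, the number $b_n$ of distinct complete lines of play of Planted Brussels Sprouts whose initial state has $n$ arms is $b_n=n^{n-2}$.
   Context: Planted Brussels Sprouts of order $n$: start with a closed disk with $n$ marked points on its boundary circle, labeled $1,\dots,n$ in clockwise order. Attached to each marked point is an arm, a short segment pointing into the interior of the disk; these arms are free. A move consists of two steps. First, choose two free arms and join their free ends by a simple curve (an arc) in the disk that does not intersect any previously drawn arc or arm; the two joined arms cease to be free. Second, mark a point (a notch) on the arc, from which two new free arms emanate, one on each side of the arc. The game ends when no move is possible. A (complete) line of play is the sequence of moves from the initial state to the end of the game. Long labels: the original arm at point $i$ has long label $i$. If an arc joins arms with long labels $\alpha$ and $\beta$, the two new arms receive long labels $(\alpha,\beta)$ and $(\beta,\alpha)$, placed so that, going clockwise around the notch, one sees the old arm $\alpha$, the new arm $(\alpha,\beta)$, the old arm $\beta$, and the new arm $(\beta,\alpha)$. Two lines of play are considered the same iff for every $k$ the two arms joined at the $k$-th move have the same long labels in both. Otherwise they are distinct. -}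

module Defs where

open import Data.Fin.Base using (Fin)
open import Data.List.Base using (List; []; _∷_; _++_; [_]; map; allFin)
open import Data.List.Relation.Binary.Pointwise as Pointwise using (Pointwise)
open import Data.Nat.Base using (ℕ)
open import Data.Product.Base using (_×_; _,_; swap)
open import Data.Sum.Base using (_⊎_; inj₁; inj₂)
open import Level using (0ℓ)
open import Relation.Binary.Bundles using (Setoid)
open import Relation.Binary.PropositionalEquality using (_≡_; refl; setoid)
open import Relation.Binary.Structures using (IsEquivalence)
open import Relation.Nullary.Negation using (¬_)
open import Function.Bundles using (Bijection)

-- Long labels.  `arm i` stands for the label toℕ i + 1.
data Label (n : ℕ) : Set where
  arm   : Fin n → Label n
  ⟨_,_⟩ : Label n → Label n → Label n

-- The arcs drawn so far cut the disk into simply connected regions, each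
-- having the free arms inside it attached to its boundary.  Up to isotopy only
-- the cyclic order of these arms matters; a region is recorded as the list of
-- their labels, clockwise along its boundary from some arbitrary arm.
Region : ℕ → Set
Region n = List (Label n)

State : ℕ → Set
State n = List (Region n)

initial : ∀ n → State n
initial n = [ map arm (allFin n) ]

infix 4 _⟶[_,_]_

-- S ⟶[ α , β ] S′: joining the free arms α and β in state S produces S′.
--
-- An arc cannot cross earlier arcs, so it can join exactly the pairs of
-- distinct arms lying in a common region.  Clockwise, the region is the cyclic
-- word α A β (B ++ X), and the arc separates A from B ++ X.  With α drawn at
-- the top, β at the bottom and hence A on the right, going clockwise around
-- the notch meets α, the right-hand arm, β, the left-hand arm.  So ⟨ α , β ⟩
-- lies on the side of A and ⟨ β , α ⟩ on the side of B ++ X.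
--
-- Taking α to precede β in the list loses nothing: exchanging the names α and
-- β yields the same two regions with the same labels.
data _⟶[_,_]_ {n : ℕ} : State n → Label n → Label n → State n → Set where
  here  : ∀ {R S α β} X A B → R ≡ X ++ α ∷ A ++ β ∷ B →
          R ∷ S ⟶[ α , β ] (⟨ α , β ⟩ ∷ A) ∷ (⟨ β , α ⟩ ∷ B ++ X) ∷ S
  there : ∀ {R S S′ α β} → S ⟶[ α , β ] S′ → R ∷ S ⟶[ α , β ] R ∷ S′

Terminal : ∀ {n} → State n → Set
Terminal S = ∀ {α β S′} → ¬ (S ⟶[ α , β ] S′)

data Line {n : ℕ} (S : State n) : Set where
  end  : Terminal S → Line S
  move : ∀ {α β S′} → S ⟶[ α , β ] S′ → Line S′ → Line S

joins : ∀ {n} {S : State n} → Line S → List (Label n × Label n)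
joins (end _)            = []
joins (move {α} {β} _ l) = (α , β) ∷ joins l

-- Equality of unordered pairs.
SamePair : {A : Set} → A × A → A × A → Set
SamePair p q = p ≡ q ⊎ p ≡ swap q

samePair-isEquivalence : {A : Set} → IsEquivalence (SamePair {A})
samePair-isEquivalence = record
  { refl  = inj₁ refl
  ; sym   = λ { (inj₁ refl) → inj₁ refl ; (inj₂ refl) → inj₂ refl }
  ; trans = λ { (inj₁ refl) q           → q
              ; (inj₂ refl) (inj₁ refl) → inj₂ refl
              ; (inj₂ refl) (inj₂ refl) → inj₁ refl }
  }

SameLine : ∀ {n} {S : State n} → Line S → Line S → Set
SameLine l m = Pointwise SamePair (joins l) (joins m)

LinesOfPlay : ℕ → Setoid 0ℓ 0ℓ
LinesOfPlay n = record
  { Carrier       = Line (initial n)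
  ; _≈_           = SameLine
  ; isEquivalence = record { refl = P.refl ; sym = P.sym ; trans = P.trans }
  }
  where module P = IsEquivalence (Pointwise.isEquivalence samePair-isEquivalence)

-- S has exactly k elements up to its equivalence.
HasCardinality : Setoid 0ℓ 0ℓ → ℕ → Set
HasCardinality S k = Bijection S (setoid (Fin k))

{-# OPTIONS --safe #-}
-- Give a position whose regions have k₁, …, kᵣ free arms the weight
-- M = ∑ (kᵢ − 1).  A move splits one region with k arms into regions with
-- i + 1 and j + 1 arms, i + j = k − 2, so it lowers M by one, and by induction
-- the number of lines of play from the position is M! ∏ kᵢ^(kᵢ−2) / (kᵢ − 1)!.
-- The inductive step is the case x = y = 1 of Abel's identity b x ⋆ a y = b (x + y),
-- where ⋆ is binomial convolution, a x m = x (x + m)^(m−1) and b x m = (x + m)^m.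
-- In terms of exponential generating functions, with T = z exp T, these are
-- exp (x T) and exp (x T) / (1 − T); the identity follows from the relations
-- D (a x) = x b (x + 1) and b x = a x + z b (x + 1) by induction on m, since D
-- is a derivation of ⋆.
--
-- Distinct moves from a position join differently labelled pairs because free
-- arms never share a label: their labels stay pairwise incomparable as subterms.
module Submission where

open import Data.Fin.Base using (Fin; zero; suc)
open import Data.List.Base using (List; []; _∷_; _++_; map; concat; concatMap; length; lookup; allFin)
open import Data.List.Membership.Propositional using (_∈_)
open import Data.List.Membership.Propositional.Properties using (∈-++⁺ˡ; ∈-++⁺ʳ; ∈-map⁺; ∈-lookup)
open import Data.List.Properties using (length-++; length-map; length-tabulate; map-∘; map-cong; map-++; ++-assoc; ++-identityʳ)
open import Data.List.Relation.Binary.Permutation.Propositional using (_↭_; prep; ↭-trans; ↭-sym; ↭-reflexive; ↭⇒↭ₛ)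
open import Data.List.Relation.Binary.Permutation.Propositional.Properties using (++⁺ˡ; ++⁺ʳ; ++-comm) renaming (shift to ↭-shift)
open import Data.List.Relation.Binary.Permutation.Setoid.Properties using (AllPairs-resp-↭)
open import Data.List.Relation.Binary.Pointwise using ([]; _∷_)
import Data.List.Relation.Unary.All.Properties as All
open import Data.List.Relation.Unary.All as All using ([]; _∷_)
import Data.List.Relation.Unary.AllPairs.Properties as AllPairs
open import Data.List.Relation.Unary.AllPairs as AllPairs using (AllPairs; []; _∷_)
import Data.List.Relation.Unary.Any.Properties as Any
open import Data.List.Relation.Unary.Any as Any using (Any; here; there)
open import Data.List.Relation.Unary.Unique.Propositional using (Unique)
open import Data.List.Relation.Unary.Unique.Propositional.Properties using (allFin⁺)
open import Data.Nat using (ℕ; zero; suc; pred; _+_; _*_; _∸_; _^_; _!; _≥_)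
open import Data.Nat.ListAction using (sum)
open import Data.Nat.ListAction.Properties using (sum-++)
open import Data.Nat.Properties using (+-assoc; +-comm; +-suc; +-identityʳ; *-assoc; *-comm; *-identityˡ; *-identityʳ; *-zeroʳ; *-distribˡ-+; *-distribʳ-+; *-cancelʳ-≡; suc-injective; _!≢0)
open import Data.Nat.Tactic.RingSolver using (solve-∀)
open import Data.Product.Base as Prod using (Σ; ∃; _×_; _,_; proj₁; proj₂)
open import Data.Sum.Base using (inj₁; inj₂)
open import Function.Base using (_∘_; id)
open import Level using (0ℓ)
open import Relation.Binary.Bundles using (Setoid)
open import Relation.Binary.PropositionalEquality using (_≡_; _≢_; refl; sym; trans; cong; cong₂; subst; subst₂; setoid; module ≡-Reasoning)
open import Relation.Nullary.Negation using (¬_; contradiction)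
open import Defs

open ≡-Reasoning

-- Binomial convolution and Abel's identity.

+-interchange : ∀ a b c d → (a + b) + (c + d) ≡ (a + c) + (b + d)
+-interchange = solve-∀

-- Binomial convolution, the product of exponential generating functions. It is defined by the
-- Leibniz rule, with D f = `f ∘ suc`, so that no binomial coefficients or subtractions enter and
-- inductions on m follow the derivation.
conv : (ℕ → ℕ) → (ℕ → ℕ) → ℕ → ℕ
conv f g zero    = f 0 * g 0
conv f g (suc m) = conv (f ∘ suc) g m + conv f (g ∘ suc) m

conv-cong : ∀ {f f′ g g′} → (∀ m → f m ≡ f′ m) → (∀ m → g m ≡ g′ m) → ∀ m → conv f g m ≡ conv f′ g′ m
conv-cong p q zero    = cong₂ _*_ (p 0) (q 0)
conv-cong p q (suc m) = cong₂ _+_ (conv-cong (p ∘ suc) q m) (conv-cong p (q ∘ suc) m)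

conv-comm : ∀ f g m → conv f g m ≡ conv g f m
conv-comm f g zero    = *-comm (f 0) (g 0)
conv-comm f g (suc m) = trans (+-comm (conv (f ∘ suc) g m) _)
  (cong₂ _+_ (conv-comm f (g ∘ suc) m) (conv-comm (f ∘ suc) g m))

conv-+ : ∀ f g h m → conv (λ i → f i + g i) h m ≡ conv f h m + conv g h m
conv-+ f g h zero    = *-distribʳ-+ (h 0) (f 0) (g 0)
conv-+ f g h (suc m) = begin
  conv (λ i → f (suc i) + g (suc i)) h m + conv (λ i → f i + g i) (h ∘ suc) m
    ≡⟨ cong₂ _+_ (conv-+ (f ∘ suc) (g ∘ suc) h m) (conv-+ f g (h ∘ suc) m) ⟩
  (conv (f ∘ suc) h m + conv (g ∘ suc) h m) + (conv f (h ∘ suc) m + conv g (h ∘ suc) m)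
    ≡⟨ +-interchange (conv (f ∘ suc) h m) _ _ _ ⟩
  conv f h (suc m) + conv g h (suc m) ∎

conv-* : ∀ c f g m → conv (λ i → c * f i) g m ≡ c * conv f g m
conv-* c f g zero    = *-assoc c (f 0) (g 0)
conv-* c f g (suc m) = trans (cong₂ _+_ (conv-* c (f ∘ suc) g m) (conv-* c f (g ∘ suc) m))
  (sym (*-distribˡ-+ c (conv (f ∘ suc) g m) _))

-- Multiplication of an exponential generating function by its variable.
shift : (ℕ → ℕ) → ℕ → ℕ
shift f zero    = 0
shift f (suc m) = suc m * f m

-- This is (z f) ⋆ g = z (f ⋆ g), by induction on m for all f and g at once: the Leibniz rule with D
-- (z f) = f + z D f reduces it to the pairs D f, g and f, D g.
conv-shift : ∀ f g m → conv (shift f) g m ≡ shift (conv f g) m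
conv-shift f g zero    = refl
conv-shift f g (suc m) = begin
  conv (λ i → f i + i * f i) g m + conv (shift f) (g ∘ suc) m
    ≡⟨ cong₂ _+_ (conv-+ f (λ i → i * f i) g m) (conv-shift f (g ∘ suc) m) ⟩
  (conv f g m + conv (λ i → i * f i) g m) + shift (conv f (g ∘ suc)) m
    ≡⟨ cong (λ z → (conv f g m + z) + shift (conv f (g ∘ suc)) m) (euler m) ⟩
  (conv f g m + shift (conv (f ∘ suc) g) m) + shift (conv f (g ∘ suc)) m
    ≡⟨ collect m ⟩
  suc m * conv f g m ∎
  where
  -- The sequence i f(i) is z D f, to which the induction hypothesis applies.
  euler : ∀ m → conv (λ i → i * f i) g m ≡ shift (conv (f ∘ suc) g) m
  euler m = trans (conv-cong (λ { zero → refl ; (suc i) → refl }) (λ _ → refl) m)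
                  (conv-shift (f ∘ suc) g m)
  distrib : ∀ k a b → ((a + b) + k * a) + k * b ≡ (a + b) + k * (a + b)
  distrib = solve-∀
  collect : ∀ m → (conv f g m + shift (conv (f ∘ suc) g) m) + shift (conv f (g ∘ suc)) m
                  ≡ suc m * conv f g m
  collect zero    = trans (+-identityʳ _) (trans (+-identityʳ _) (sym (+-identityʳ _)))
  collect (suc m) = distrib (suc m) (conv (f ∘ suc) g m) (conv f (g ∘ suc) m)

-- `a x 0` reads x (x + 0)^(-1) as 1, also at x = 0, where exp (x T) is the constant series 1.
a b : ℕ → ℕ → ℕ
a x zero    = 1
a x (suc m) = x * (x + suc m) ^ m
b x m       = (x + m) ^ m

b-suc : ∀ x m → b (suc x) m ≡ (x + suc m) ^ m
b-suc x m = cong (_^ m) (sym (+-suc x m))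

a-deriv : ∀ x m → a x (suc m) ≡ x * b (suc x) m
a-deriv x m = cong (x *_) (sym (b-suc x m))

-- One factor x + m of (x + m)^m is distributed: x gives the term of `a x`, and m gives the term of
-- z b (x + 1).
b-split : ∀ x m → b x m ≡ a x m + shift (b (suc x)) m
b-split x zero    = refl
b-split x (suc m) = begin
  (x + suc m) * (x + suc m) ^ m                        ≡⟨ *-distribʳ-+ ((x + suc m) ^ m) x (suc m) ⟩
  x * (x + suc m) ^ m + suc m * (x + suc m) ^ m        ≡⟨ cong (λ z → a x (suc m) + suc m * z) (b-suc x m) ⟨
  a x (suc m) + suc m * b (suc x) m                    ∎

-- The induction on m keeps x and y general, because every use of the hypothesis raises its first
-- argument by one, and one use also exchanges x and y.
abel : ∀ m x y → conv (b x) (a y) m ≡ b (x + y) m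
abel zero    x y = refl
abel (suc m) x y = begin
  conv (b x) (a y) (suc m)
    ≡⟨ conv-cong (b-split x) (λ _ → refl) (suc m) ⟩
  conv (λ i → a x i + shift (b (suc x)) i) (a y) (suc m)
    ≡⟨ conv-+ (a x) (shift (b (suc x))) (a y) (suc m) ⟩
  conv (a x) (a y) (suc m) + conv (shift (b (suc x))) (a y) (suc m)
    ≡⟨ cong₂ _+_ a⋆a (trans (conv-shift (b (suc x)) (a y) (suc m)) (cong (suc m *_) (abel m (suc x) y))) ⟩
  a (x + y) (suc m) + suc m * b (suc (x + y)) m
    ≡⟨ b-split (x + y) (suc m) ⟨
  b (x + y) (suc m) ∎
  where
  -- The law exp (x T) exp (y T) = exp ((x + y) T), checked on derivatives: D (a x) = x b (x + 1)
  -- turns each Leibniz term into an instance of `abel` at the smaller index m.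
  a⋆a : conv (a x) (a y) (suc m) ≡ a (x + y) (suc m)
  a⋆a = begin
    conv (a x ∘ suc) (a y) m + conv (a x) (a y ∘ suc) m
      ≡⟨ cong₂ _+_ (half x y) (trans (conv-comm (a x) (a y ∘ suc) m) (half y x)) ⟩
    x * b (suc (x + y)) m + y * b (suc (y + x)) m
      ≡⟨ cong (λ z → x * b (suc (x + y)) m + y * b (suc z) m) (+-comm y x) ⟩
    x * b (suc (x + y)) m + y * b (suc (x + y)) m
      ≡⟨ *-distribʳ-+ (b (suc (x + y)) m) x y ⟨
    (x + y) * b (suc (x + y)) m
      ≡⟨ a-deriv (x + y) m ⟨
    a (x + y) (suc m) ∎
    where
    half : ∀ x y → conv (a x ∘ suc) (a y) m ≡ x * b (suc (x + y)) m
    half x y = begin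
      conv (a x ∘ suc) (a y) m              ≡⟨ conv-cong (a-deriv x) (λ _ → refl) m ⟩
      conv (λ i → x * b (suc x) i) (a y) m  ≡⟨ conv-* x (b (suc x)) (a y) m ⟩
      x * conv (b (suc x)) (a y) m          ≡⟨ cong (x *_) (abel m (suc x) y) ⟩
      x * b (suc (x + y)) m                 ∎

-- Binomial coefficients, antidiagonal sums and tree numbers.

-- The coefficient (i + j)! / (i! j!), indexed by the sizes of both parts so that Pascal's rule is a
-- structural recursion without subtraction.
binom : ℕ → ℕ → ℕ
binom zero    j       = 1
binom (suc i) zero    = 1
binom (suc i) (suc j) = binom i (suc j) + binom (suc i) j

-- Pascal's two terms contribute i + 1 and j + 1 times the same factorial.
binom-! : ∀ i j → binom i j * (i ! * j !) ≡ (i + j) !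
binom-! zero    j       = trans (*-identityˡ _) (*-identityˡ _)
binom-! (suc i) zero    = trans (*-identityˡ _) (trans (*-identityʳ _) (cong (_!) (sym (+-identityʳ (suc i)))))
binom-! (suc i) (suc j) = begin
  (binom i (suc j) + binom (suc i) j) * ((suc i * i !) * (suc j * j !))
    ≡⟨ expand (binom i (suc j)) (binom (suc i) j) (suc i) (i !) (suc j) (j !) ⟩
  suc i * (binom i (suc j) * (i ! * (suc j) !)) + suc j * (binom (suc i) j * ((suc i) ! * j !))
    ≡⟨ cong₂ (λ p q → suc i * p + suc j * q) (binom-! i (suc j)) (binom-! (suc i) j) ⟩
  suc i * (i + suc j) ! + suc j * (suc (i + j)) !
    ≡⟨ cong (λ k → suc i * (i + suc j) ! + suc j * k !) (+-suc i j) ⟨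
  suc i * (i + suc j) ! + suc j * (i + suc j) !
    ≡⟨ *-distribʳ-+ ((i + suc j) !) (suc i) (suc j) ⟨
  (suc i + suc j) ! ∎
  where
  expand : ∀ p q s k t l → (p + q) * ((s * k) * (t * l)) ≡ s * (p * (k * (t * l))) + t * (q * ((s * k) * l))
  expand = solve-∀

diag : (ℕ → ℕ → ℕ) → ℕ → ℕ
diag h zero    = h 0 0
diag h (suc m) = h 0 (suc m) + diag (h ∘ suc) m

diag-cong : ∀ {h k} → (∀ i j → h i j ≡ k i j) → ∀ m → diag h m ≡ diag k m
diag-cong h≡k zero    = h≡k 0 0
diag-cong h≡k (suc m) = cong₂ _+_ (h≡k 0 (suc m)) (diag-cong (h≡k ∘ suc) m)

diag-+ : ∀ h k m → diag (λ i j → h i j + k i j) m ≡ diag h m + diag k m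
diag-+ h k zero    = refl
diag-+ h k (suc m) = trans (cong (h 0 (suc m) + k 0 (suc m) +_) (diag-+ (h ∘ suc) (k ∘ suc) m))
  (+-interchange (h 0 (suc m)) _ _ _)

-- The recursion of `diag` peels off the end i = 0; peeling off j = 0 instead serves the sums whose
-- term at that end vanishes.
diag-snoc : ∀ h m → diag h (suc m) ≡ diag (λ i j → h i (suc j)) m + h (suc m) 0
diag-snoc h zero    = refl
diag-snoc h (suc m) = trans (cong (h 0 (suc (suc m)) +_) (diag-snoc (h ∘ suc) m)) (sym (+-assoc (h 0 (suc (suc m))) _ _))

conv≡diag : ∀ f g m → conv f g m ≡ diag (λ i j → binom i j * (f i * g j)) m
conv≡diag f g zero    = sym (*-identityˡ _)
conv≡diag f g (suc m) = begin
  conv (f ∘ suc) g m + conv f (g ∘ suc) m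
    ≡⟨ cong₂ _+_ (conv≡diag (f ∘ suc) g m) (conv≡diag f (g ∘ suc) m) ⟩
  diag p (suc m) + diag (λ i j → q i (suc j)) m
    ≡⟨ cong (diag p (suc m) +_) (+-identityʳ _) ⟨
  diag p (suc m) + (diag (λ i j → q i (suc j)) m + 0)
    ≡⟨ cong (diag p (suc m) +_) (diag-snoc q m) ⟨
  diag p (suc m) + diag q (suc m)
    ≡⟨ diag-+ p q (suc m) ⟨
  diag (λ i j → p i j + q i j) (suc m)
    ≡⟨ diag-cong pascal (suc m) ⟩
  diag (λ i j → binom i j * (f i * g j)) (suc m) ∎
  where
  -- The two halves of Pascal's rule, extended by zero to the ends of the antidiagonal. The value at
  -- (0, 0) is set so that `pascal` holds for all pairs, as `diag-cong` demands.
  p q : ℕ → ℕ → ℕ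
  p zero    j       = 0
  p (suc i) j       = binom i j * (f (suc i) * g j)
  q i       (suc j) = binom i j * (f i * g (suc j))
  q zero    zero    = 1 * (f 0 * g 0)
  q (suc i) zero    = 0
  pascal : ∀ i j → p i j + q i j ≡ binom i j * (f i * g j)
  pascal zero    zero    = refl
  pascal zero    (suc j) = refl
  pascal (suc i) zero    = trans (+-identityʳ _) (cong (_* (f (suc i) * g 0)) (binom-i-0 i))
    where
    binom-i-0 : ∀ i → binom i 0 ≡ 1
    binom-i-0 zero    = refl
    binom-i-0 (suc i) = refl
  pascal (suc i) (suc j) = sym (*-distribʳ-+ (f (suc i) * g (suc j)) (binom i (suc j)) (binom (suc i) j))

-- Cayley's number of labelled trees on k vertices. Truncated subtraction yields the right value 1
-- at k = 1, and makes k = 0 a neutral factor 1.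
trees : ℕ → ℕ
trees k = k ^ (k ∸ 2)

-- The factor `suc j` raises (j + 1)^(j-1) to (j + 1)^j, which turns the second series into `b 1`;
-- the first is `a 1`. What remains is Abel's identity at x = y = 1.
trees-splits : ∀ m → diag (λ i j → suc j * (binom i j * (trees (suc i) * trees (suc j)))) m ≡ trees (suc (suc m))
trees-splits m = begin
  diag (λ i j → suc j * (binom i j * (trees (suc i) * trees (suc j)))) m
    ≡⟨ diag-cong (λ i j → trans (regroup (suc j) (binom i j) (trees (suc i)) (trees (suc j)))
                                (cong₂ (λ s t → binom i j * (s * t)) (trees-a i) (trees-b j))) m ⟩
  diag (λ i j → binom i j * (a 1 i * b 1 j)) m  ≡⟨ conv≡diag (a 1) (b 1) m ⟨
  conv (a 1) (b 1) m                            ≡⟨ conv-comm (a 1) (b 1) m ⟩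
  conv (b 1) (a 1) m                            ≡⟨ abel m 1 1 ⟩
  trees (suc (suc m))                           ∎
  where
  regroup : ∀ j c s t → j * (c * (s * t)) ≡ c * (s * (j * t))
  regroup = solve-∀
  trees-a : ∀ i → trees (suc i) ≡ a 1 i
  trees-a zero    = refl
  trees-a (suc i) = sym (*-identityˡ _)
  trees-b : ∀ j → suc j * trees (suc j) ≡ b 1 j
  trees-b zero    = refl
  trees-b (suc j) = refl

sum-map-scale : ∀ {A : Set} (f g : A → ℕ) k c → (∀ x → f x * k ≡ c * g x) → ∀ xs →
                sum (map f xs) * k ≡ c * sum (map g xs)
sum-map-scale f g k c eq []       = sym (*-zeroʳ c)
sum-map-scale f g k c eq (x ∷ xs) = begin
  (f x + sum (map f xs)) * k          ≡⟨ *-distribʳ-+ k (f x) _ ⟩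
  f x * k + sum (map f xs) * k        ≡⟨ cong₂ _+_ (eq x) (sum-map-scale f g k c eq xs) ⟩
  c * g x + c * sum (map g xs)        ≡⟨ *-distribˡ-+ c (g x) _ ⟨
  c * (g x + sum (map g xs))          ∎

-- Choosing one or two letters of a word: sums over the choices and their distinctness.

data Cut {A : Set} : List A → Set where
  cut : ∀ xs y ys → Cut (xs ++ y ∷ ys)

-- Indexing by the word itself lets a match on the choice refine the word. When the first chosen
-- letter is the head, the second is a `Cut` of the tail.
data Split {A : Set} : List A → Set where
  split : ∀ xs x ys y zs → Split (xs ++ x ∷ ys ++ y ∷ zs)

module _ {A : Set} where

  mid : {xs : List A} → Cut xs → A
  mid (cut _ y _) = y

  mid∈ : {xs : List A} (c : Cut xs) → mid c ∈ xs
  mid∈ (cut xs y ys) = ∈-++⁺ʳ xs (here refl)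

  left right : {xs : List A} → Cut xs → ℕ
  left  (cut xs _ _) = length xs
  right (cut _ _ ys) = length ys

  consCut : ∀ x {xs : List A} → Cut xs → Cut (x ∷ xs)
  consCut x (cut ys y zs) = cut (x ∷ ys) y zs

  cuts : (xs : List A) → List (Cut xs)
  cuts []       = []
  cuts (x ∷ xs) = cut [] x xs ∷ map (consCut x) (cuts xs)

  cuts-complete : ∀ xs (y : A) ys → cut xs y ys ∈ cuts (xs ++ y ∷ ys)
  cuts-complete []       y ys = here refl
  cuts-complete (x ∷ xs) y ys = there (∈-map⁺ (consCut x) (cuts-complete xs y ys))

  ends : {xs : List A} → Split xs → A × A
  ends (split _ x _ y _) = x , y

  -- The lengths of the two words between the chosen letters of a cyclic word.
  inner outer : {xs : List A} → Split xs → ℕ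
  inner (split _ _ ys _ _)  = length ys
  outer (split xs _ _ _ zs) = length (zs ++ xs)

  headSplit : ∀ x {xs : List A} → Cut xs → Split (x ∷ xs)
  headSplit x (cut ys y zs) = split [] x ys y zs

  tailSplit : ∀ x {xs : List A} → Split xs → Split (x ∷ xs)
  tailSplit w (split xs x ys y zs) = split (w ∷ xs) x ys y zs

  splits : (xs : List A) → List (Split xs)
  splits []       = []
  splits (x ∷ xs) = map (headSplit x) (cuts xs) ++ map (tailSplit x) (splits xs)

  splits-complete : ∀ xs (x : A) ys y zs → split xs x ys y zs ∈ splits (xs ++ x ∷ ys ++ y ∷ zs)
  splits-complete []       x ys y zs = ∈-++⁺ˡ (∈-map⁺ (headSplit x) (cuts-complete ys y zs))
  splits-complete (w ∷ xs) x ys y zs =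
    ∈-++⁺ʳ (map (headSplit w) (cuts (xs ++ x ∷ ys ++ y ∷ zs)))
           (∈-map⁺ (tailSplit w) (splits-complete xs x ys y zs))

  inner+outer : {xs : List A} (s : Split xs) → suc (suc (inner s + outer s)) ≡ length xs
  inner+outer (split xs x ys y zs) = begin
    suc (suc (length ys + length (zs ++ xs)))           ≡⟨ cong (λ k → suc (suc (length ys + k))) (length-++ zs) ⟩
    suc (suc (length ys + (length zs + length xs)))     ≡⟨ rotate (length xs) (length ys) (length zs) ⟩
    length xs + suc (length ys + suc (length zs))       ≡⟨ cong (λ k → length xs + suc k) (length-++ ys) ⟨
    length xs + length (x ∷ ys ++ y ∷ zs)               ≡⟨ length-++ xs ⟨
    length (xs ++ x ∷ ys ++ y ∷ zs)                     ∎
    where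
    rotate : ∀ p q r → 2 + (q + (r + p)) ≡ p + (1 + (q + (1 + r)))
    rotate = solve-∀

  left-cons : ∀ x {xs : List A} (c : Cut xs) → left (consCut x c) ≡ suc (left c)
  left-cons _ (cut _ _ _) = refl

  right-cons : ∀ x {xs : List A} (c : Cut xs) → right (consCut x c) ≡ right c
  right-cons _ (cut _ _ _) = refl

  inner-tail : ∀ x {xs : List A} (s : Split xs) → inner (tailSplit x s) ≡ inner s
  inner-tail _ (split _ _ _ _ _) = refl

  outer-tail : ∀ x {xs : List A} (s : Split xs) → outer (tailSplit x s) ≡ suc (outer s)
  outer-tail w (split xs x ys y zs) =
    trans (length-++ zs) (trans (+-suc (length zs) (length xs)) (cong suc (sym (length-++ zs))))

  -- A letter is determined by the number of letters before it, so each (i, j) with i + j = m occurs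
  -- once.
  sum-cuts : ∀ (xs : List A) m → length xs ≡ suc m → (h : ℕ → ℕ → ℕ) →
             sum (map (λ c → h (left c) (right c)) (cuts xs)) ≡ diag h m
  sum-cuts (x ∷ [])         zero    refl h = +-identityʳ _
  sum-cuts (x ∷ xs@(_ ∷ _)) (suc m) eq   h = cong₂ _+_ (cong (h 0) (suc-injective eq)) (begin
    sum (map (λ c → h (left c) (right c)) (map (consCut x) (cuts xs)))
      ≡⟨ cong sum (map-∘ (cuts xs)) ⟨
    sum (map (λ c → h (left (consCut x c)) (right (consCut x c))) (cuts xs))
      ≡⟨ cong sum (map-cong (λ c → cong₂ h (left-cons x c) (right-cons x c)) (cuts xs)) ⟩
    sum (map (λ c → h (suc (left c)) (right c)) (cuts xs))
      ≡⟨ sum-cuts xs m (suc-injective eq) (h ∘ suc) ⟩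
    diag (h ∘ suc) m ∎)

  -- If the head is chosen, the second letter cuts the tail. If not, the head belongs to the outer
  -- word and lengthens it by one.
  sum-splits-∷ : ∀ x (xs : List A) m → length xs ≡ suc m → (h : ℕ → ℕ → ℕ) →
    sum (map (λ s → h (inner s) (outer s)) (splits (x ∷ xs))) ≡
    diag h m + sum (map (λ s → h (inner s) (suc (outer s))) (splits xs))
  sum-splits-∷ x xs m eq h = begin
    sum (map H (map (headSplit x) (cuts xs) ++ map (tailSplit x) (splits xs)))
      ≡⟨ cong sum (map-++ H (map (headSplit x) (cuts xs)) _) ⟩
    sum (map H (map (headSplit x) (cuts xs)) ++ map H (map (tailSplit x) (splits xs)))
      ≡⟨ sum-++ (map H (map (headSplit x) (cuts xs))) _ ⟩
    sum (map H (map (headSplit x) (cuts xs))) + sum (map H (map (tailSplit x) (splits xs)))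
      ≡⟨ cong₂ _+_ heads tails ⟩
    diag h m + sum (map (λ s → h (inner s) (suc (outer s))) (splits xs)) ∎
    where
    H : Split (x ∷ xs) → ℕ
    H s = h (inner s) (outer s)
    H-head : ∀ c → H (headSplit x c) ≡ h (left c) (right c)
    H-head (cut ys _ zs) = cong (h (length ys) ∘ length) (++-identityʳ zs)
    heads : sum (map H (map (headSplit x) (cuts xs))) ≡ diag h m
    heads = trans (cong sum (trans (sym (map-∘ (cuts xs))) (map-cong H-head (cuts xs))))
                  (sum-cuts xs m eq h)
    tails : sum (map H (map (tailSplit x) (splits xs))) ≡
            sum (map (λ s → h (inner s) (suc (outer s))) (splits xs))
    tails = cong sum (trans (sym (map-∘ (splits xs)))
      (map-cong (λ s → cong₂ h (inner-tail x s) (outer-tail x s)) (splits xs)))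

  -- The factor counts the positions of the first letter of the list: it is
  -- the first chosen letter or lies in the outer word.
  sum-splits : ∀ (xs : List A) m → length xs ≡ suc (suc m) → (h : ℕ → ℕ → ℕ) →
               sum (map (λ s → h (inner s) (outer s)) (splits xs)) ≡ diag (λ i j → suc j * h i j) m
  sum-splits (x ∷ y ∷ []) zero    eq h = sum-splits-∷ x (y ∷ []) zero refl h
  sum-splits (x ∷ xs)     (suc m) eq h = begin
    sum (map (λ s → h (inner s) (outer s)) (splits (x ∷ xs)))
      ≡⟨ sum-splits-∷ x xs (suc m) (suc-injective eq) h ⟩
    diag h (suc m) + sum (map (λ s → h (inner s) (suc (outer s))) (splits xs))
      ≡⟨ cong (diag h (suc m) +_) (sum-splits xs m (suc-injective eq) (λ i j → h i (suc j))) ⟩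
    diag h (suc m) + diag (λ i j → suc j * h i (suc j)) m
      -- The weight j vanishes at the end j = 0, so the sum over pairs (i, j + 1) extends to the
      -- full antidiagonal and merges with the one from the head.
      ≡⟨ cong (diag h (suc m) +_) (+-identityʳ _) ⟨
    diag h (suc m) + (diag (λ i j → suc j * h i (suc j)) m + 0)
      ≡⟨ cong (diag h (suc m) +_) (diag-snoc (λ i j → j * h i j) m) ⟨
    diag h (suc m) + diag (λ i j → j * h i j) (suc m)
      ≡⟨ diag-+ h (λ i j → j * h i j) (suc m) ⟨
    diag (λ i j → suc j * h i j) (suc m) ∎

  -- Multiplying the hypothesis by the binomial coefficient turns i! j! into the common factor m!,
  -- after which `trees-splits` evaluates the sum. The parameters u and c carry the factors of the
  -- other regions. With fewer than two letters both sides are 0.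
  sum-region : ∀ (xs : List A) (N : Split xs → ℕ) u c →
    (∀ s → N s * (inner s ! * (outer s ! * u)) ≡ c * (trees (suc (inner s)) * trees (suc (outer s)))) →
    sum (map N (splits xs)) * (pred (length xs) ! * u) ≡ pred (length xs) * (c * trees (length xs))
  sum-region []               N u c eq = refl
  sum-region (_ ∷ [])         N u c eq = refl
  sum-region xs@(_ ∷ _ ∷ zs)  N u c eq = begin
    sum (map N (splits xs)) * (suc m * m ! * u)
      ≡⟨ pull (sum (map N (splits xs))) (suc m) (m !) u ⟩
    suc m * (sum (map N (splits xs)) * (m ! * u))
      ≡⟨ cong (suc m *_) (sum-map-scale N (λ s → h (inner s) (outer s)) (m ! * u) c scale (splits xs)) ⟩
    suc m * (c * sum (map (λ s → h (inner s) (outer s)) (splits xs)))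
      ≡⟨ cong (λ z → suc m * (c * z)) (trans (sum-splits xs m refl h) (trees-splits m)) ⟩
    suc m * (c * trees (suc (suc m))) ∎
    where
    m : ℕ
    m = length zs
    h : ℕ → ℕ → ℕ
    h i j = binom i j * (trees (suc i) * trees (suc j))
    pull : ∀ s k f u → s * (k * f * u) ≡ k * (s * (f * u))
    pull = solve-∀
    regroup : ∀ n β i j u → n * (β * (i * j) * u) ≡ β * (n * (i * (j * u)))
    regroup = solve-∀
    swap* : ∀ β c t → β * (c * t) ≡ c * (β * t)
    swap* = solve-∀
    scale : ∀ s → N s * (m ! * u) ≡ c * h (inner s) (outer s)
    scale s = begin
      N s * (m ! * u)
        ≡⟨ cong (λ k → N s * (k ! * u)) (suc-injective (suc-injective (inner+outer s))) ⟨
      N s * ((inner s + outer s) ! * u)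
        ≡⟨ cong (λ k → N s * (k * u)) (binom-! (inner s) (outer s)) ⟨
      N s * (binom (inner s) (outer s) * (inner s ! * outer s !) * u)
        ≡⟨ regroup (N s) (binom (inner s) (outer s)) (inner s !) (outer s !) u ⟩
      binom (inner s) (outer s) * (N s * (inner s ! * (outer s ! * u)))
        ≡⟨ cong (binom (inner s) (outer s) *_) (eq s) ⟩
      binom (inner s) (outer s) * (c * (trees (suc (inner s)) * trees (suc (outer s))))
        ≡⟨ swap* (binom (inner s) (outer s)) c _ ⟩
      c * h (inner s) (outer s) ∎

  proj₁∈ : ∀ {p q : A × A} {xs} → SamePair p q → proj₁ q ∈ xs → proj₂ q ∈ xs → proj₁ p ∈ xs
  proj₁∈ (inj₁ refl) q₁∈ q₂∈ = q₁∈
  proj₁∈ (inj₂ refl) q₁∈ q₂∈ = q₂∈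

  ends∈ : {xs : List A} (s : Split xs) → proj₁ (ends s) ∈ xs × proj₂ (ends s) ∈ xs
  ends∈ (split xs x ys y zs) = ∈-++⁺ʳ xs (here refl) , ∈-++⁺ʳ xs (there (∈-++⁺ʳ ys (here refl)))

  Apart : {xs : List A} → Split xs → Split xs → Set
  Apart s t = ¬ SamePair (ends s) (ends t)

  mid-cons : ∀ x {xs : List A} (c : Cut xs) → mid (consCut x c) ≡ mid c
  mid-cons _ (cut _ _ _) = refl

  ends-head : ∀ x {xs : List A} (c : Cut xs) → ends (headSplit x c) ≡ (x , mid c)
  ends-head _ (cut _ _ _) = refl

  ends-tail : ∀ x {xs : List A} (s : Split xs) → ends (tailSplit x s) ≡ ends s
  ends-tail _ (split _ _ _ _ _) = refl

  cuts-unique : {xs : List A} → Unique xs → AllPairs (λ c d → mid c ≢ mid d) (cuts xs)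
  cuts-unique []                    = []
  cuts-unique {x ∷ xs} (x∉xs ∷ xs!) =
    All.map⁺ (All.universal (λ c eq → All.lookup x∉xs (mid∈ c) (trans eq (mid-cons x c))) (cuts xs)) ∷
    AllPairs.map⁺ (AllPairs.map
      (λ {c} {d} → subst₂ _≢_ (sym (mid-cons x c)) (sym (mid-cons x d)))
      (cuts-unique xs!))

  -- Two pairs containing the head differ in their other letter. Any other coincidence, including
  -- one with the order swapped, would make the head recur in the tail.
  splits-unique : {xs : List A} → Unique xs → AllPairs Apart (splits xs)
  splits-unique []                    = []
  splits-unique {x ∷ xs} (x∉xs ∷ xs!) = AllPairs.++⁺
    (AllPairs.map⁺ (AllPairs.map (λ {c} {d} → heads c d) (cuts-unique xs!)))
    (AllPairs.map⁺ (AllPairs.map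
      (λ {s} {t} → subst₂ (λ p q → ¬ SamePair p q) (sym (ends-tail x s)) (sym (ends-tail x t)))
      (splits-unique xs!)))
    (All.map⁺ (All.universal (λ c → All.map⁺ (All.universal (mixed c) (splits xs))) (cuts xs)))
    where
    heads : ∀ c d → mid c ≢ mid d → Apart (headSplit x c) (headSplit x d)
    heads c d c≢d eq with subst₂ SamePair (ends-head x c) (ends-head x d) eq
    ... | inj₁ p = c≢d (cong proj₂ p)
    ... | inj₂ p = All.lookup x∉xs (mid∈ d) (cong proj₁ p)
    mixed : ∀ c s → Apart (headSplit x c) (tailSplit x s)
    mixed c s eq = All.lookup x∉xs
      (proj₁∈ (subst₂ SamePair (ends-head x c) (ends-tail x s) eq) (proj₁ (ends∈ s)) (proj₂ (ends∈ s))) refl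

  Unique-++⁻ : ∀ (xs : List A) {ys} → Unique (xs ++ ys) →
               Unique xs × Unique ys × (∀ {z} → z ∈ xs → ¬ z ∈ ys)
  Unique-++⁻ []       ys!          = [] , ys! , λ ()
  Unique-++⁻ (x ∷ xs) (x∉ ∷ xsys!) with Unique-++⁻ xs xsys!
  ... | xs! , ys! , disjoint = All.++⁻ˡ xs x∉ ∷ xs! , ys! , λ
    { (here refl) z∈ys  → All.lookup (All.++⁻ʳ xs x∉) z∈ys refl
    ; (there z∈xs) z∈ys → disjoint z∈xs z∈ys }

-- The moves available in a position.

record Move {n} (S : State n) : Set where
  constructor mkMove
  field
    {α β}  : Label n
    {next} : State n
    step   : S ⟶[ α , β ] next

open Move

module _ {n : ℕ} where

  joined : {S : State n} → Move S → Label n × Label n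
  joined t = α t , β t

  hereMove : ∀ {R} {S : State n} → Split R → Move (R ∷ S)
  hereMove (split X _ A _ B) = mkMove (here X A B refl)

  joined-here : ∀ {R} {S : State n} (s : Split R) → joined (hereMove {S = S} s) ≡ ends s
  joined-here (split _ _ _ _ _) = refl

  thereMove : ∀ {R} {S : State n} → Move S → Move (R ∷ S)
  thereMove (mkMove t) = mkMove (there t)

  moves : (S : State n) → List (Move S)
  moves []      = []
  moves (R ∷ S) = map hereMove (splits R) ++ map thereMove (moves S)

  moves-complete : ∀ {S S′ : State n} {α β} (t : S ⟶[ α , β ] S′) → mkMove t ∈ moves S
  moves-complete (here X A B refl)   = ∈-++⁺ˡ (∈-map⁺ hereMove (splits-complete X _ A _ B))
  moves-complete (there {R = R} t)   =
    ∈-++⁺ʳ (map hereMove (splits R)) (∈-map⁺ thereMove (moves-complete t))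

  joined∈ : ∀ {S : State n} (t : Move S) → α t ∈ concat S × β t ∈ concat S
  joined∈ (mkMove (here X A B refl)) = Prod.map ∈-++⁺ˡ ∈-++⁺ˡ (ends∈ (split X _ A _ B))
  joined∈ (mkMove (there {R = R} t)) = Prod.map (∈-++⁺ʳ R) (∈-++⁺ʳ R) (joined∈ (mkMove t))

  -- Within one region this is `splits-unique`; across regions the pairs differ because no label is
  -- shared.
  moves-unique : ∀ S → Unique (concat S) → AllPairs (λ s t → ¬ SamePair (joined s) (joined t)) (moves S)
  moves-unique []      _ = []
  moves-unique (R ∷ S) RS! with Unique-++⁻ R RS!
  ... | R! , S! , disjoint = AllPairs.++⁺
    (AllPairs.map⁺ (AllPairs.map
      (λ {s} {t} → subst₂ (λ p q → ¬ SamePair p q) (sym (joined-here s)) (sym (joined-here t)))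
      (splits-unique R!)))
    (AllPairs.map⁺ (moves-unique S S!))
    (All.map⁺ (All.universal (λ s → All.map⁺ (All.universal (mixed s) (moves S))) (splits R)))
    where
    mixed : ∀ s (t : Move S) → ¬ SamePair (joined (hereMove {S = S} s)) (joined t)
    mixed s t eq = disjoint (proj₁ (ends∈ s))
      (proj₁∈ (subst (λ p → SamePair p (joined t)) (joined-here s) eq) (proj₁ (joined∈ t)) (proj₂ (joined∈ t)))

  -- Weights and the counting formula.

  weight : State n → ℕ
  weight []      = 0
  weight (R ∷ S) = pred (length R) + weight S

  -- The two sides of the fraction in the counting formula, kept apart so that all identities stay
  -- in the natural numbers.
  denom numer : State n → ℕ
  denom []      = 1
  denom (R ∷ S) = pred (length R) ! * denom S
  numer []      = 1
  numer (R ∷ S) = trees (length R) * numer S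

  -- Moves in a region with k arms contribute k - 1 to the factor `weight S`. Passing to the
  -- remaining regions puts the factors of the head region into u and c, so the induction needs both
  -- arbitrary.
  sum-moves : ∀ (S : State n) (N : Move S → ℕ) u c →
              (∀ t → N t * (u * denom (next t)) ≡ c * numer (next t)) →
              sum (map N (moves S)) * (u * denom S) ≡ weight S * (c * numer S)
  sum-moves []      N u c eq = refl
  sum-moves (R ∷ S) N u c eq = begin
    sum (map N (map hereMove (splits R) ++ map thereMove (moves S))) * (u * (d * D))
      ≡⟨ cong (λ l → sum l * (u * (d * D))) (map-++ N (map hereMove (splits R)) _) ⟩
    sum (map N (map hereMove (splits R)) ++ map N (map thereMove (moves S))) * (u * (d * D))
      ≡⟨ cong (_* (u * (d * D))) (sum-++ (map N (map hereMove (splits R))) _) ⟩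
    (sum (map N (map hereMove (splits R))) + sum (map N (map thereMove (moves S)))) * (u * (d * D))
      ≡⟨ cong₂ (λ k l → (sum k + sum l) * (u * (d * D))) (map-∘ (splits R)) (map-∘ (moves S)) ⟨
    (H + T) * (u * (d * D))
      ≡⟨ expand H T u d D ⟩
    H * (d * (u * D)) + T * (u * d * D)
      ≡⟨ cong₂ _+_ heres theres ⟩
    pred (length R) * (c * P * p) + weight S * (c * p * P)
      ≡⟨ collect (pred (length R)) (weight S) c p P ⟩
    (pred (length R) + weight S) * (c * (p * P)) ∎
    where
    d D p P H T : ℕ
    d = pred (length R) !
    D = denom S
    p = trees (length R)
    P = numer S
    H = sum (map (N ∘ hereMove) (splits R))
    T = sum (map (N ∘ thereMove) (moves S))
    expand : ∀ H T u d D → (H + T) * (u * (d * D)) ≡ H * (d * (u * D)) + T * (u * d * D)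
    expand = solve-∀
    collect : ∀ k w c p P → k * (c * P * p) + w * (c * p * P) ≡ (k + w) * (c * (p * P))
    collect = solve-∀
    denom-regroup : ∀ N i j u D → N * (i * (j * (u * D))) ≡ N * (u * (i * (j * D)))
    denom-regroup = solve-∀
    numer-regroup : ∀ c i j P → c * (i * (j * P)) ≡ c * P * (i * j)
    numer-regroup = solve-∀
    heres : H * (d * (u * D)) ≡ pred (length R) * (c * P * p)
    heres = sum-region R (N ∘ hereMove) (u * D) (c * P) λ
      -- Matching makes `next (hereMove s)` compute to regions with `suc (inner s)` and
      -- `suc (outer s)` arms.
      { s@(split _ _ _ _ _) → begin
          N (hereMove s) * (inner s ! * (outer s ! * (u * D)))
            ≡⟨ denom-regroup (N (hereMove s)) (inner s !) (outer s !) u D ⟩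
          N (hereMove s) * (u * (inner s ! * (outer s ! * D)))
            ≡⟨ eq (hereMove s) ⟩
          c * (trees (suc (inner s)) * (trees (suc (outer s)) * P))
            ≡⟨ numer-regroup c (trees (suc (inner s))) (trees (suc (outer s))) P ⟩
          c * P * (trees (suc (inner s)) * trees (suc (outer s))) ∎ }
    theres : T * (u * d * D) ≡ weight S * (c * p * P)
    theres = sum-moves S (N ∘ thereMove) (u * d) (c * p) λ t → begin
      N (thereMove t) * (u * d * denom (next t))     ≡⟨ cong (N (thereMove t) *_) (*-assoc u d _) ⟩
      N (thereMove t) * (u * (d * denom (next t)))   ≡⟨ eq (thereMove t) ⟩
      c * (p * numer (next t))                       ≡⟨ *-assoc c p _ ⟨
      c * p * numer (next t)                         ∎

  weight-step : ∀ {S S′ : State n} {α β} → S ⟶[ α , β ] S′ → weight S ≡ suc (weight S′)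
  weight-step {_ ∷ S} (here X A B refl) = begin
    pred (length (X ++ _ ∷ A ++ _ ∷ B)) + weight S
      ≡⟨ cong (λ k → pred k + weight S) (inner+outer (split X _ A _ B)) ⟨
    suc (length A + length (B ++ X)) + weight S
      ≡⟨ cong suc (+-assoc (length A) _ _) ⟩
    suc (length A + (length (B ++ X) + weight S)) ∎
  weight-step {R ∷ _} (there t) = trans (cong (pred (length R) +_) (weight-step t)) (+-suc _ _)

  -- Each region has at most one arm, since `pred` vanishes only at 0 and 1, and there the factorial
  -- and the tree number are both 1.
  weight≡0⇒denom≡numer : ∀ (S : State n) → weight S ≡ 0 → denom S ≡ numer S
  weight≡0⇒denom≡numer []             _  = refl
  weight≡0⇒denom≡numer ([] ∷ S)       eq = cong (1 *_) (weight≡0⇒denom≡numer S eq)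
  weight≡0⇒denom≡numer ((_ ∷ []) ∷ S) eq = cong (1 *_) (weight≡0⇒denom≡numer S eq)

  movable : ∀ (S : State n) {m} → weight S ≡ suc m → Move S
  movable ([] ∷ S)          eq = thereMove (movable S eq)
  movable ((_ ∷ []) ∷ S)    eq = thereMove (movable S eq)
  movable ((_ ∷ _ ∷ R) ∷ S) eq = mkMove (here [] [] R refl)

  -- The subterm order and incomparability of free labels.

  infix 4 _⊑_

  data _⊑_ : Label n → Label n → Set where
    ⊑-refl  : ∀ {x} → x ⊑ x
    ⊑-left  : ∀ {x y z} → x ⊑ y → x ⊑ ⟨ y , z ⟩
    ⊑-right : ∀ {x y z} → x ⊑ z → x ⊑ ⟨ y , z ⟩

  ⊑-trans : ∀ {x y z} → x ⊑ y → y ⊑ z → x ⊑ z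
  ⊑-trans p ⊑-refl      = p
  ⊑-trans p (⊑-left q)  = ⊑-left (⊑-trans p q)
  ⊑-trans p (⊑-right q) = ⊑-right (⊑-trans p q)

  Incomparable : Label n → Label n → Set
  Incomparable x y = ¬ x ⊑ y × ¬ y ⊑ x

  -- Mere distinctness of the free labels would not be preserved by moves.
  Antichain : List (Label n) → Set
  Antichain = AllPairs Incomparable

  Antichain-resp-↭ : ∀ {xs ys} → xs ↭ ys → Antichain xs → Antichain ys
  Antichain-resp-↭ p = AllPairs-resp-↭ (setoid (Label n)) Prod.swap
    ((λ { refl → id }) , (λ { refl → id })) (↭⇒↭ₛ p)

  Antichain⇒Unique : ∀ {xs} → Antichain xs → Unique xs
  Antichain⇒Unique = AllPairs.map λ { (x⋢y , _) refl → x⋢y ⊑-refl }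

  -- Incomparability ignores order and regions, so only the multiset of free labels matters; Z holds
  -- the arms that the move leaves alone.
  step-↭ : ∀ {S S′ : State n} {α β} → S ⟶[ α , β ] S′ →
           ∃ λ Z → concat S ↭ α ∷ β ∷ Z × concat S′ ↭ ⟨ α , β ⟩ ∷ ⟨ β , α ⟩ ∷ Z
  step-↭ {_ ∷ S} {α = α} {β} (here X A B refl) = (A ++ B ++ X) ++ concat S ,
    ++⁺ʳ (concat S) (↭-trans (↭-shift α X _) (prep α (↭-trans (++-comm X _)
      (↭-trans (↭-reflexive (++-assoc A (β ∷ B) X)) (↭-shift β A (B ++ X)))))) ,
    prep _ (↭-trans (↭-shift _ A _) (prep _ (↭-reflexive (sym (++-assoc A (B ++ X) (concat S))))))
  step-↭ {R ∷ _} (there t) with step-↭ t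
  ... | Z , p , q = R ++ Z , raise p , raise q
    where
    raise : ∀ {x y} {T : List (Label n)} → T ↭ x ∷ y ∷ Z → R ++ T ↭ x ∷ y ∷ R ++ Z
    raise {x} {y} r = ↭-trans (++⁺ˡ R r) (↭-trans (↭-shift x R _) (prep x (↭-shift y R Z)))

  -- Any comparison involving a new label yields one between its components, or between a component
  -- and an old label, and these were excluded before the move.
  Antichain-join : ∀ {x y Z} → Antichain (x ∷ y ∷ Z) → Antichain (⟨ x , y ⟩ ∷ ⟨ y , x ⟩ ∷ Z)
  Antichain-join {x} {y} ((x∥y ∷ x∥Z) ∷ y∥Z ∷ Z∥) =
    ((twins x∥y , twins (Prod.swap x∥y)) ∷ All.zipWith old (x∥Z , y∥Z)) ∷
    All.zipWith old (y∥Z , x∥Z) ∷ Z∥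
    where
    twins : ∀ {x y} → Incomparable x y → ¬ ⟨ x , y ⟩ ⊑ ⟨ y , x ⟩
    twins (x⋢y , y⋢x) ⊑-refl      = x⋢y ⊑-refl
    twins (x⋢y , y⋢x) (⊑-left p)  = x⋢y (⊑-trans (⊑-left ⊑-refl) p)
    twins (x⋢y , y⋢x) (⊑-right p) = y⋢x (⊑-trans (⊑-right ⊑-refl) p)
    old : ∀ {x y z} → Incomparable x z × Incomparable y z → Incomparable ⟨ x , y ⟩ z
    old ((x⋢z , z⋢x) , (y⋢z , z⋢y)) =
      (λ p → x⋢z (⊑-trans (⊑-left ⊑-refl) p)) ,
      λ { ⊑-refl → x⋢z (⊑-left ⊑-refl) ; (⊑-left p) → z⋢x p ; (⊑-right p) → z⋢y p }

  Antichain-step : ∀ {S S′ : State n} {α β} → S ⟶[ α , β ] S′ →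
                   Antichain (concat S) → Antichain (concat S′)
  Antichain-step t anti with step-↭ t
  ... | Z , p , q = Antichain-resp-↭ (↭-sym q) (Antichain-join (Antichain-resp-↭ p anti))

  -- Listing and counting the lines of play.

  record Enumeration (S : State n) : Set where
    field
      lines    : List (Line S)
      complete : ∀ l → Any (SameLine l) lines
      distinct : AllPairs (λ l m → ¬ SameLine l m) lines

  open Enumeration

  -- The counting formula with its denominator cleared.
  Count : ∀ {S : State n} → Enumeration S → Set
  Count {S} e = length (lines e) * denom S ≡ weight S ! * numer S

  -- Each move lowers the weight by one, so the recursion is on the weight, exposed as `m`.
  -- Positions of weight 0 are exactly the terminal ones.
  enumerate : ∀ m (S : State n) → weight S ≡ m → Antichain (concat S) → Σ (Enumeration S) Count
  enumerate zero    S w anti = e , (begin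
      1 * denom S           ≡⟨ cong (1 *_) (weight≡0⇒denom≡numer S w) ⟩
      1 * numer S           ≡⟨ cong (λ k → k ! * numer S) w ⟨
      weight S ! * numer S  ∎)
    where
    stuck : Terminal S
    stuck t with () ← trans (sym w) (weight-step t)
    e : Enumeration S
    e .lines               = end stuck ∷ []
    e .complete (end _)    = here []
    e .complete (move t _) = contradiction t stuck
    e .distinct            = [] ∷ []
  enumerate (suc m) S w anti = e , count
    where
    weight-next : (t : Move S) → weight (next t) ≡ m
    weight-next t = suc-injective (trans (sym (weight-step (step t))) w)
    rest : (t : Move S) → Σ (Enumeration (next t)) Count
    rest t = enumerate m (next t) (weight-next t) (Antichain-step (step t) anti)
    after : (t : Move S) → List (Line S)
    after t = map (move (step t)) (lines (proj₁ (rest t)))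
    e : Enumeration S
    e .lines               = concatMap after (moves S)
    e .complete (end stop) = contradiction (step (movable S w)) stop
    e .complete (move t l) = Any.concatMap⁺ after (Any.map
      (λ { refl → Any.map⁺ (Any.map (inj₁ refl ∷_) (complete (proj₁ (rest (mkMove t))) l)) })
      (moves-complete t))
    -- Lines with the same first move differ later; lines with different first moves already differ
    -- in the first pair, by `moves-unique`.
    e .distinct            = AllPairs.concat⁺
      (All.map⁺ (All.universal
        (λ t → AllPairs.map⁺ (AllPairs.map (λ { l≉m (_ ∷ l≈m) → l≉m l≈m }) (distinct (proj₁ (rest t)))))
        (moves S)))
      (AllPairs.map⁺ (AllPairs.map
        (λ {s} {t} s≢t → All.map⁺ (All.universal
          (λ l → All.map⁺ (All.universal (λ { m (s~t ∷ _) → s≢t s~t }) (lines (proj₁ (rest t)))))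
          (lines (proj₁ (rest s)))))
        (moves-unique S (Antichain⇒Unique anti))))
    N : Move S → ℕ
    N t = length (lines (proj₁ (rest t)))
    length-lines : ∀ ts → length (concatMap after ts) ≡ sum (map N ts)
    length-lines []       = refl
    length-lines (t ∷ ts) = trans (length-++ (after t))
      (cong₂ _+_ (length-map (move (step t)) (lines (proj₁ (rest t)))) (length-lines ts))
    count : Count e
    count = begin
      length (concatMap after (moves S)) * denom S
        ≡⟨ cong₂ _*_ (length-lines (moves S)) (sym (*-identityˡ (denom S))) ⟩
      sum (map N (moves S)) * (1 * denom S)
        -- All successors have weight m, so their formulas share the factor `m !`, which serves as
        -- c.
        ≡⟨ sum-moves S N 1 (m !) (λ t → begin
             N t * (1 * denom (next t))         ≡⟨ cong (N t *_) (*-identityˡ _) ⟩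
             N t * denom (next t)               ≡⟨ proj₂ (rest t) ⟩
             weight (next t) ! * numer (next t) ≡⟨ cong (λ k → k ! * numer (next t)) (weight-next t) ⟩
             m ! * numer (next t)               ∎) ⟩
      weight S * (m ! * numer S)  ≡⟨ cong (_* (m ! * numer S)) w ⟩
      suc m * (m ! * numer S)     ≡⟨ *-assoc (suc m) (m !) (numer S) ⟨
      suc m ! * numer S           ≡⟨ cong (λ k → k ! * numer S) w ⟨
      weight S ! * numer S        ∎

-- From an enumeration to a cardinality, and the initial position.

module _ (S : Setoid 0ℓ 0ℓ) where

  open Setoid S using (Carrier; _≈_) renaming (sym to ≈-sym; trans to ≈-trans)

  lookup-injective : ∀ {xs} → AllPairs (λ x y → ¬ x ≈ y) xs →
                     ∀ i j → lookup xs i ≈ lookup xs j → i ≡ j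
  lookup-injective (_  ∷ _)   zero    zero    _  = refl
  lookup-injective (x≉ ∷ _)   zero    (suc j) eq = contradiction eq (All.lookup x≉ (∈-lookup j))
  lookup-injective (x≉ ∷ _)   (suc i) zero    eq = contradiction (≈-sym eq) (All.lookup x≉ (∈-lookup i))
  lookup-injective (_  ∷ xs!) (suc i) (suc j) eq = cong suc (lookup-injective xs! i j eq)

  enumeration⇒cardinality : ∀ xs → (∀ x → Any (x ≈_) xs) → AllPairs (λ x y → ¬ x ≈ y) xs →
                            HasCardinality S (length xs)
  enumeration⇒cardinality xs all xs! = record
    { to        = position
    -- Equivalent elements might be located at different positions; distinctness of the entries
    -- excludes this.
    ; cong      = λ {x} {y} x≈y → lookup-injective xs! _ _
        (≈-trans (≈-sym (at x)) (≈-trans x≈y (at y)))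
    ; bijective =
        (λ {x} {y} eq → ≈-trans (subst (λ i → x ≈ lookup xs i) eq (at x)) (≈-sym (at y))) ,
        λ i → lookup xs i , λ {x} x≈ → lookup-injective xs! _ _ (≈-trans (≈-sym (at x)) x≈)
    }
    where
    position : Carrier → Fin (length xs)
    position x = Any.index (all x)
    at : ∀ x → x ≈ lookup xs (position x)
    at x = Any.lookup-index (all x)

-- An original arm has no proper subterm, so comparable arms are equal.
initial-antichain : ∀ n → Antichain (concat (initial n))
initial-antichain n = subst Antichain (sym (++-identityʳ _))
  (AllPairs.map⁺ (AllPairs.map (λ i≢j → (λ { ⊑-refl → i≢j refl }) , λ { ⊑-refl → i≢j refl })
    (allFin⁺ n)))

theorem3 : (n : ℕ) → n ≥ 1 → HasCardinality (LinesOfPlay n) (n ^ (n ∸ 2))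
theorem3 n _ = subst (HasCardinality (LinesOfPlay n)) length≡
  (enumeration⇒cardinality (LinesOfPlay n) (lines e) (complete e) (distinct e))
  where
  open Enumeration
  enumerated : Σ (Enumeration (initial n)) Count
  enumerated = enumerate (weight (initial n)) (initial n) refl (initial-antichain n)
  e : Enumeration (initial n)
  e = proj₁ enumerated
  arms : length (map arm (allFin n)) ≡ n
  arms = trans (length-map arm (allFin n)) (length-tabulate id)
  length≡ : length (lines e) ≡ n ^ (n ∸ 2)
  -- With a single region of n arms, the weight is n - 1 and the denominator is its factorial, so (n
  -- - 1)! cancels.
  length≡ = *-cancelʳ-≡ _ _ (pred n !) {{pred n !≢0}} (begin
    length (lines e) * pred n !
      ≡⟨ cong (λ k → length (lines e) * k) (trans (*-identityʳ _) (cong (λ k → pred k !) arms)) ⟨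
    length (lines e) * denom (initial n)
      ≡⟨ proj₂ enumerated ⟩
    weight (initial n) ! * numer (initial n)
      ≡⟨ cong₂ (λ k l → k ! * l) (trans (+-identityʳ _) (cong pred arms)) (trans (*-identityʳ _) (cong trees arms)) ⟩
    pred n ! * trees n
      ≡⟨ *-comm (pred n !) (trees n) ⟩
    trees n * pred n ! ∎)
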